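{- Let $p$ be a prime with $p\equiv 1\pmod 3$. Then $$\sum_{\substack{k=0\\ k\neq (p-1)/3}}^{(p-1)/2}\frac{\binom{2k}{k}}{3k+1}\equiv 0\pmod p.$$
   Context: For $0\le k\le (p-1)/2$ with $k\neq (p-1)/3$, the integer $3k+1$ is not divisible by $p$, so each summand is a rational number whose denominator is prime to $p$; the congruence is understood in the ring of rationals with denominators prime to $p$ (equivalently in $\mathbb{Z}_p$). -}

module Defs where

open import Data.Integer.Base using (+_)
open import Data.List.Base using (List; foldr; map; filter; upTo)
open import Data.Nat.Base as ℕ using (ℕ)
open import Data.Nat.Combinatorics using (_C_)
open import Data.Nat.Coprimality using (Coprime)
open import Data.Nat.Properties using (_≟_)
open import Data.Product.Base using (_×_; ∃-syntax)
open import Data.Rational.Base using (ℚ; 0ℚ; _+_; _-_; _*_; _/_; ↧ₙ_)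
open import Relation.Binary.PropositionalEquality.Core using (_≡_)
open import Relation.Nullary.Decidable using (¬?)

-- Membership in the subring of ℚ of rationals with denominator prime to p;
-- elements of ℚ are in lowest terms, so ↧ₙ x is the reduced denominator.
Integral : ℕ → ℚ → Set
Integral p x = Coprime (↧ₙ x) p

infix 4 _≡_[mod_]

-- Congruence modulo the ideal generated by p in that subring. Both sides are
-- required to lie in the subring.
_≡_[mod_] : ℚ → ℚ → ℕ → Set
x ≡ y [mod p ] =
  Integral p x × Integral p y ×
  ∃[ z ] Integral p z × x - y ≡ (+ p / 1) * z

∑ : List ℕ → (ℕ → ℚ) → ℚ
∑ ks f = foldr _+_ 0ℚ (map f ks)

-- upTo n lists 0, …, n - 1, hence the successor.
indices : ℕ → List ℕ
indices p =
  filter (λ k → ¬? (k ≟ (p ℕ.∸ 1) ℕ./ 3)) (upTo (ℕ.suc ((p ℕ.∸ 1) ℕ./ 2)))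

-- The denominator 3k + 1 is written 1 + 3k so that it is visibly nonzero.
summand : ℕ → ℚ
summand k = + ((2 ℕ.* k) C k) / (1 ℕ.+ 3 ℕ.* k)

{-# OPTIONS --safe #-}
module Submission where

open import Defs
open import Data.Integer.Base using (ℤ; +_; -_; _+_; _-_; _*_; _^_; 0ℤ; 1ℤ; -1ℤ; ∣_∣)
open import Data.Integer.Divisibility.Signed
  using (_∣_; divides; ∣ᵤ⇒∣; ∣⇒∣ᵤ; ∣m∣n⇒∣m+n; ∣m⇒∣-m; ∣m⇒∣m*n; ∣n⇒∣m*n)
import Data.Integer.Properties as ℤ
open import Data.Integer.Tactic.RingSolver using (solve-∀)
open import Data.List.Base using (List; []; _∷_; applyUpTo; upTo; filter; foldr; map)
open import Data.List.Properties using (map-upTo; filter-accept; filter-reject)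
open import Data.List.Relation.Unary.All using (All; []; _∷_)
open import Data.List.Relation.Unary.All.Properties using (applyUpTo⁺₁)
open import Data.Nat.Base as ℕ using (ℕ; zero; suc; z≤n; s≤s; _%_)
open import Data.Nat.Combinatorics using (_C_; nCk+nC[k+1]≡[n+1]C[k+1]; nCn≡1; nC1≡n)
open import Data.Nat.Combinatorics.Specification using (k>n⇒nCk≡0)
open import Data.Nat.Coprimality using (recompute; coprime-divisor) renaming (sym to coprime-sym)
import Data.Nat.Divisibility as ℕ
import Data.Nat.DivMod as ℕ
open import Data.Nat.Primality using (Prime; euclidsLemma; prime⇒irreducible; ¬prime[0]; ¬prime[1])
import Data.Nat.Properties as ℕ
import Data.Nat.Tactic.RingSolver as ℕRing
open import Data.Product.Base using (_,_; _×_; ∃-syntax)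
open import Data.Rational.Base as ℚ using (ℚ; 0ℚ; ↧ₙ_; mkℚ; toℚᵘ; _/_)
import Data.Rational.Properties as ℚ
open import Data.Rational.Solver using (module +-*-Solver)
open import Data.Rational.Unnormalised.Base as ℚᵘ using (mkℚᵘ; *≡*)
import Data.Rational.Unnormalised.Properties as ℚᵘ
open import Data.Sum.Base as Sum using (_⊎_; inj₁; inj₂)
open import Function.Base using (_∘_)
open import Level using (0ℓ)
open import Relation.Binary.Bundles using (Setoid)
open import Relation.Binary.Definitions using (tri<; tri≈; tri>)
open import Relation.Binary.PropositionalEquality
import Relation.Binary.Reasoning.Setoid
open import Relation.Nullary.Decidable using (yes; no; ¬?)
open import Relation.Nullary.Negation using (¬_; contradiction)

-- Let p = 2n + 1 = 3m + 1, let T be the shift of sequences, Δ = 1 - T, and let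
-- w(e) = (3e + 1)ᵖ⁻², a polynomial sequence of degree p - 2 which modulo p is
-- 1 / (3e + 1), or 0 when p ∣ 3e + 1. As (2k choose k) ≡ (n choose k) (-4)ᵏ, the sum
-- is ((1 - 4T)ⁿ w)(0) modulo p. Since Δᵖ w = 0, (2 + T)ᵖ w = (3 - Δ)ᵖ w ≡ 3ᵖ w, so it
-- suffices that (1 - 4T)ⁿ (2 + T)²ⁿ⁺¹ w vanishes at 0. The curve y² = 1 - 4x³ has a
-- 3-isogeny, visible as the identity (1 - 4T)(2 + T)² = 4Δ³ - 27T², and expanding the
-- n-th power of the right side leaves the values of Δ³ᵏ (2 + T) w at 2n - 2k, k ≤ n.
-- These are 0 for 3k ≥ p - 1 by degree. For 3k < p - 1, Leibniz' rule makes them, up to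
-- a unit, values of Δ³ᵏ⁺¹ applied to (3e + 1) w(e), which by Fermat is the constant 1
-- at all the points involved.

-- Polynomials in the shift operator, acting on integer sequences.

Seq : Set
Seq = ℕ → ℤ

-- A coefficient list c₀ ∷ c₁ ∷ … stands for the polynomial c₀ + c₁ T + … in the
-- shift operator (T u) e = u (suc e).
act : List ℤ → Seq → Seq
act []       u e = 0ℤ
act (c ∷ cs) u e = c * u e + act cs u (suc e)

iter : List ℤ → ℕ → Seq → Seq
iter cs zero    u = u
iter cs (suc n) u = act cs (iter cs n u)

act-cong : ∀ cs {u v} → u ≗ v → act cs u ≗ act cs v
act-cong []       u≗v e = refl
act-cong (c ∷ cs) u≗v e = cong₂ (λ a b → c * a + b) (u≗v e) (act-cong cs u≗v (suc e))

iter-cong : ∀ cs n {u v} → u ≗ v → iter cs n u ≗ iter cs n v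
iter-cong cs zero    u≗v = u≗v
iter-cong cs (suc n) u≗v = act-cong cs (iter-cong cs n u≗v)

act-zero : ∀ cs e → act cs (λ _ → 0ℤ) e ≡ 0ℤ
act-zero []       e = refl
act-zero (c ∷ cs) e = cong₂ _+_ (ℤ.*-zeroʳ c) (act-zero cs (suc e))

-- Inductive step of `act-comm`: the operator `d ∷ ds` is `d` plus the shift composed with `ds`, and
-- `act cs` is linear and commutes with the shift.
act-scale-shift : ∀ cs d u v e →
  act cs (λ i → d * u i + v (suc i)) e ≡ d * act cs u e + act cs v (suc e)
act-scale-shift []       d u v e = sym (trans (ℤ.+-identityʳ (d * 0ℤ)) (ℤ.*-zeroʳ d))
act-scale-shift (c ∷ cs) d u v e =
  trans (cong (_+_ (c * (d * u e + v (suc e)))) (act-scale-shift cs d u v (suc e)))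
        (rearrange c d (u e) (v (suc e)) (act cs u (suc e)) (act cs v (suc (suc e))))
  where
  rearrange : ∀ c d x y s t → c * (d * x + y) + (d * s + t) ≡ d * (c * x + s) + (c * y + t)
  rearrange = solve-∀

act-comm : ∀ cs ds u → act cs (act ds u) ≗ act ds (act cs u)
act-comm cs []       u e = act-zero cs e
act-comm cs (d ∷ ds) u e =
  trans (act-scale-shift cs d u (act ds u) e)
        (cong (_+_ (d * act cs u e)) (act-comm cs ds u (suc e)))

iter-act : ∀ cs n ds u → iter cs n (act ds u) ≗ act ds (iter cs n u)
iter-act cs zero    ds u e = refl
iter-act cs (suc n) ds u e =
  trans (act-cong cs (iter-act cs n ds u) e) (act-comm cs ds (iter cs n u) e)

iter-iter : ∀ cs n ds m u → iter cs n (iter ds m u) ≗ iter ds m (iter cs n u)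
iter-iter cs n ds zero    u e = refl
iter-iter cs n ds (suc m) u e =
  trans (iter-act cs n ds (iter ds m u) e) (act-cong ds (iter-iter cs n ds m u) e)

iter-+ : ∀ cs m n u → iter cs (m ℕ.+ n) u ≗ iter cs m (iter cs n u)
iter-+ cs zero    n u e = refl
iter-+ cs (suc m) n u e = act-cong cs (iter-+ cs m n u) e

-- The operator identity behind the 3-isogeny.

-- Q = 4Δ³ - 27T² = M L².
Δ L M Q : List ℤ
Δ = 1ℤ ∷ -1ℤ ∷ []
L = + 2 ∷ 1ℤ ∷ []
M = 1ℤ ∷ - + 4 ∷ []
Q = + 4 ∷ - + 12 ∷ - + 15 ∷ - + 4 ∷ []

Q-difference : ∀ u e → act Q u e ≡ + 4 * iter Δ 3 u e - + 27 * u (2 ℕ.+ e)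
Q-difference u e = identity (u e) (u (1 ℕ.+ e)) (u (2 ℕ.+ e)) (u (3 ℕ.+ e))
  where
  identity : ∀ a b c d →
    + 4 * a + (- + 12 * b + (- + 15 * c + (- + 4 * d + 0ℤ))) ≡
    + 4 * (1ℤ * (1ℤ * (1ℤ * a + (-1ℤ * b + 0ℤ)) + (-1ℤ * (1ℤ * b + (-1ℤ * c + 0ℤ)) + 0ℤ))
      + (-1ℤ * (1ℤ * (1ℤ * b + (-1ℤ * c + 0ℤ)) + (-1ℤ * (1ℤ * c + (-1ℤ * d + 0ℤ)) + 0ℤ)) + 0ℤ))
    - + 27 * c
  identity = solve-∀

Q-factor : ∀ u e → act Q u e ≡ act M (iter L 2 u) e
Q-factor u e = identity (u e) (u (1 ℕ.+ e)) (u (2 ℕ.+ e)) (u (3 ℕ.+ e))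
  where
  identity : ∀ a b c d →
    + 4 * a + (- + 12 * b + (- + 15 * c + (- + 4 * d + 0ℤ))) ≡
    1ℤ * (+ 2 * (+ 2 * a + (1ℤ * b + 0ℤ)) + (1ℤ * (+ 2 * b + (1ℤ * c + 0ℤ)) + 0ℤ))
      + (- + 4 * (+ 2 * (+ 2 * b + (1ℤ * c + 0ℤ)) + (1ℤ * (+ 2 * c + (1ℤ * d + 0ℤ)) + 0ℤ)) + 0ℤ)
  identity = solve-∀

-- Shift polynomials commute, so each new pair of factors `L` can be moved past the powers of `M`.
-- The exponent is `n * 2` because `suc n * 2` unfolds to two further applications of `L`.
iter-Q-factor : ∀ n u → iter Q n u ≗ iter M n (iter L (n ℕ.* 2) u)
iter-Q-factor zero    u e = refl
iter-Q-factor (suc n) u e = begin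
  act Q (iter Q n u) e                                ≡⟨ act-cong Q (iter-Q-factor n u) e ⟩
  act Q (iter M n (iter L (n ℕ.* 2) u)) e
    ≡⟨ Q-factor (iter M n (iter L (n ℕ.* 2) u)) e ⟩
  act M (iter L 2 (iter M n (iter L (n ℕ.* 2) u))) e
    ≡⟨ act-cong M (iter-iter L 2 M n (iter L (n ℕ.* 2) u)) e ⟩
  act M (iter M n (iter L 2 (iter L (n ℕ.* 2) u))) e  ∎
  where open ≡-Reasoning

-- Finite differences of polynomial sequences.

Δ-step : ∀ u e → act Δ u e ≡ u e - u (suc e)
Δ-step u e = identity (u e) (u (suc e))
  where
  identity : ∀ a b → 1ℤ * a + (-1ℤ * b + 0ℤ) ≡ a - b
  identity = solve-∀

ℓ : Seq
ℓ e = + (1 ℕ.+ 3 ℕ.* e)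

ℓ-suc : ∀ e → ℓ (suc e) ≡ ℓ e + + 3
ℓ-suc e = trans (cong (λ n → + (1 ℕ.+ n)) (trans (ℕ.*-suc 3 e) (ℕ.+-comm 3 (3 ℕ.* e))))
  (ℤ.pos-+ (1 ℕ.+ 3 ℕ.* e) 3)

-- Leibniz' rule has only two terms here because `ℓ` is linear: its first difference is the constant
-- -3 and its second difference is 0.
Δ-leibniz : ∀ N v e →
  iter Δ (suc N) (λ i → ℓ i * v i) e ≡
  ℓ e * iter Δ (suc N) v e - + 3 * + suc N * iter Δ N v (suc e)
Δ-leibniz zero v e = begin
  act Δ (λ i → ℓ i * v i) e            ≡⟨ Δ-step (λ i → ℓ i * v i) e ⟩
  ℓ e * v e - ℓ (suc e) * v (suc e)    ≡⟨ cong (λ a → ℓ e * v e - a * v (suc e)) (ℓ-suc e) ⟩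
  ℓ e * v e - (ℓ e + + 3) * v (suc e)  ≡⟨ identity (ℓ e) (v e) (v (suc e)) ⟩
  ℓ e * (v e - v (suc e)) - + 3 * + 1 * v (suc e)
    ≡⟨ cong (λ a → ℓ e * a - + 3 * + 1 * v (suc e)) (Δ-step v e) ⟨
  ℓ e * act Δ v e - + 3 * + 1 * v (suc e) ∎
  where
  open ≡-Reasoning
  identity : ∀ l a b → l * a - (l + + 3) * b ≡ l * (a - b) - + 3 * + 1 * b
  identity = solve-∀
Δ-leibniz (suc N) v e = begin
  act Δ (iter Δ (suc N) (λ i → ℓ i * v i)) e
    ≡⟨ Δ-step (iter Δ (suc N) (λ i → ℓ i * v i)) e ⟩
  iter Δ (suc N) (λ i → ℓ i * v i) e - iter Δ (suc N) (λ i → ℓ i * v i) (suc e)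
    ≡⟨ cong₂ _-_ (Δ-leibniz N v e) (Δ-leibniz N v (suc e)) ⟩
  (ℓ e * a₀ - + 3 * + suc N * b₁) - (ℓ (suc e) * a₁ - + 3 * + suc N * b₂)
    ≡⟨ cong (λ l → (ℓ e * a₀ - + 3 * + suc N * b₁) - (l * a₁ - + 3 * + suc N * b₂)) (ℓ-suc e) ⟩
  (ℓ e * a₀ - + 3 * + suc N * b₁) - ((ℓ e + + 3) * a₁ - + 3 * + suc N * b₂)
    ≡⟨ identity₁ (ℓ e) a₀ a₁ b₁ b₂ (+ suc N) ⟩
  ℓ e * (a₀ - a₁) - + 3 * a₁ - + 3 * + suc N * (b₁ - b₂)
    ≡⟨ cong₂ (λ x y → ℓ e * x - + 3 * a₁ - + 3 * + suc N * y) (Δ-step (iter Δ (suc N) v) e) (Δ-step (iter Δ N v) (suc e)) ⟨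
  ℓ e * act Δ (iter Δ (suc N) v) e - + 3 * a₁ - + 3 * + suc N * a₁
    ≡⟨ identity₂ (ℓ e * act Δ (iter Δ (suc N) v) e) a₁ (+ suc N) ⟩
  ℓ e * act Δ (iter Δ (suc N) v) e - + 3 * (1ℤ + + suc N) * a₁ ∎
  where
  open ≡-Reasoning
  a₀ a₁ b₁ b₂ : ℤ
  a₀ = iter Δ (suc N) v e
  a₁ = iter Δ (suc N) v (suc e)
  b₁ = iter Δ N v (suc e)
  b₂ = iter Δ N v (suc (suc e))
  identity₁ : ∀ l a₀ a₁ b₁ b₂ n →
    (l * a₀ - + 3 * n * b₁) - ((l + + 3) * a₁ - + 3 * n * b₂) ≡
    l * (a₀ - a₁) - + 3 * a₁ - + 3 * n * (b₁ - b₂)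
  identity₁ = solve-∀
  identity₂ : ∀ x a n → x - + 3 * a - + 3 * n * a ≡ x - + 3 * (1ℤ + n) * a
  identity₂ = solve-∀

Δ-one : ∀ N e → iter Δ (suc N) (λ _ → 1ℤ) e ≡ 0ℤ
Δ-one zero    e = refl
Δ-one (suc N) e = trans (act-cong Δ (Δ-one N) e) (act-zero Δ e)

-- Induction on the degree: with one factor `ℓ` split off, Leibniz' rule leaves two differences of
-- `ℓ ^ d`, of consecutive orders that both still exceed `d`.
Δ-power : ∀ d N → d ℕ.< N → ∀ e → iter Δ N (λ i → ℓ i ^ d) e ≡ 0ℤ
Δ-power zero    (suc N)       d<N       e = Δ-one N e
Δ-power (suc d) (suc (suc N)) (s≤s d<N) e = begin
  iter Δ (suc (suc N)) (λ i → ℓ i * ℓ i ^ d) e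
    ≡⟨ Δ-leibniz (suc N) _ e ⟩
  ℓ e * iter Δ (suc (suc N)) (λ i → ℓ i ^ d) e - + 3 * + suc (suc N) * iter Δ (suc N) (λ i → ℓ i ^ d) (suc e)
    ≡⟨ cong₂ (λ x y → ℓ e * x - + 3 * + suc (suc N) * y)
         (Δ-power d (suc (suc N)) (ℕ.m<n⇒m<1+n d<N) e) (Δ-power d (suc N) d<N (suc e)) ⟩
  ℓ e * 0ℤ - + 3 * + suc (suc N) * 0ℤ
    ≡⟨ identity (ℓ e) (+ 3 * + suc (suc N)) ⟩
  0ℤ ∎
  where
  open ≡-Reasoning
  identity : ∀ a b → a * 0ℤ - b * 0ℤ ≡ 0ℤ
  identity = solve-∀

-- Finite sums and the binomial theorem for operators.

sumTo : ℕ → Seq → ℤ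
sumTo zero    f = 0ℤ
sumTo (suc n) f = f 0 + sumTo n (λ k → f (suc k))

sumTo-cong : ∀ n {f g} → f ≗ g → sumTo n f ≡ sumTo n g
sumTo-cong zero    f≗g = refl
sumTo-cong (suc n) f≗g = cong₂ _+_ (f≗g 0) (sumTo-cong n (λ k → f≗g (suc k)))

sumTo-+ : ∀ n f g → sumTo n (λ k → f k + g k) ≡ sumTo n f + sumTo n g
sumTo-+ zero    f g = refl
sumTo-+ (suc n) f g =
  trans (cong (_+_ (f 0 + g 0)) (sumTo-+ n (λ k → f (suc k)) (λ k → g (suc k))))
        (identity (f 0) (g 0) (sumTo n (λ k → f (suc k))) (sumTo n (λ k → g (suc k))))
  where
  identity : ∀ a b s t → a + b + (s + t) ≡ a + s + (b + t)
  identity = solve-∀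

sumTo-*ˡ : ∀ n c f → sumTo n (λ k → c * f k) ≡ c * sumTo n f
sumTo-*ˡ zero    c f = sym (ℤ.*-zeroʳ c)
sumTo-*ˡ (suc n) c f =
  trans (cong (_+_ (c * f 0)) (sumTo-*ˡ n c (λ k → f (suc k))))
        (sym (ℤ.*-distribˡ-+ c (f 0) (sumTo n (λ k → f (suc k)))))

sumTo-zero : ∀ n f → (∀ k → f k ≡ 0ℤ) → sumTo n f ≡ 0ℤ
sumTo-zero zero    f f≡0 = refl
sumTo-zero (suc n) f f≡0 = cong₂ _+_ (f≡0 0) (sumTo-zero n _ (λ k → f≡0 (suc k)))

sumTo-last : ∀ n f → sumTo (suc n) f ≡ sumTo n f + f n
sumTo-last zero    f = ℤ.+-comm (f 0) 0ℤ
sumTo-last (suc n) f =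
  trans (cong (_+_ (f 0)) (sumTo-last n (λ k → f (suc k)))) (sym (ℤ.+-assoc (f 0) _ _))

-- Any bound N above n will do, since the binomial coefficients vanish beyond n.
binomial : ∀ (c d : ℤ) (a : ℕ → Seq) →
  (∀ n j → a (suc n) j ≡ c * a n j + d * a n (suc j)) →
  ∀ n N j → n ℕ.< N →
  a n j ≡ sumTo N (λ k → + (n C k) * (c ^ (n ℕ.∸ k) * d ^ k * a 0 (k ℕ.+ j)))
binomial c d a step zero (suc N) j _ =
  sym (trans (cong₂ _+_ (identity (a 0 j))
    (sumTo-zero N _ (λ k → ℤ.*-zeroˡ (1ℤ * d ^ suc k * a 0 (suc k ℕ.+ j))))) (ℤ.+-identityʳ (a 0 j)))
  where
  identity : ∀ x → 1ℤ * (1ℤ * 1ℤ * x) ≡ x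
  identity = solve-∀
binomial c d a step (suc n) (suc N) j (s≤s n<N) = begin
  a (suc n) j
    ≡⟨ step n j ⟩
  c * a n j + d * a n (suc j)
    -- The two bounds differ by one, so that both sums have length `N` once the head of the first is
    -- split off and Pascal's rule can be applied termwise.
    ≡⟨ cong₂ (λ x y → c * x + d * y) (binomial c d a step n (suc N) j (ℕ.m<n⇒m<1+n n<N))
         (binomial c d a step n N (suc j) n<N) ⟩
  c * sumTo (suc N) (term n j) + d * sumTo N (term n (suc j))
    ≡⟨ cong₂ _+_ (sumTo-*ˡ (suc N) c (term n j)) (sumTo-*ˡ N d (term n (suc j))) ⟨
  c * term n j 0 + sumTo N (λ k → c * term n j (suc k)) + sumTo N (λ k → d * term n (suc j) k)
    ≡⟨ ℤ.+-assoc (c * term n j 0) _ _ ⟩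
  c * term n j 0 + (sumTo N (λ k → c * term n j (suc k)) + sumTo N (λ k → d * term n (suc j) k))
    ≡⟨ cong₂ _+_ (head-term c (+ (n C 0)) (c ^ n) (a 0 j)) (trans (sym (sumTo-+ N _ _)) (sumTo-cong N pascal)) ⟩
  sumTo (suc N) (term (suc n) j) ∎
  where
  open ≡-Reasoning
  term : ℕ → ℕ → Seq
  term n j k = + (n C k) * (c ^ (n ℕ.∸ k) * d ^ k * a 0 (k ℕ.+ j))
  head-term : ∀ c b p x → c * (b * (p * 1ℤ * x)) ≡ b * (c * p * 1ℤ * x)
  head-term = solve-∀
  -- For `k ≥ n` truncated subtraction makes both exponents 0, and the extra `c` is harmless only
  -- because `n C suc k` vanishes.
  absorb : ∀ k → c * + (n C suc k) * c ^ (n ℕ.∸ suc k) ≡ + (n C suc k) * c ^ (n ℕ.∸ k)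
  absorb k with suc k ℕ.≤? n
  ... | yes k<n = trans (trans (cong (_* c ^ (n ℕ.∸ suc k)) (ℤ.*-comm c _)) (ℤ.*-assoc (+ (n C suc k)) c _))
                        (cong (λ i → + (n C suc k) * c ^ i) (sym (ℕ.+-∸-assoc 1 k<n)))
  ... | no  k≮n rewrite k>n⇒nCk≡0 (ℕ.≰⇒> k≮n) =
    trans (cong (_* c ^ (n ℕ.∸ suc k)) (ℤ.*-zeroʳ c))
      (trans (ℤ.*-zeroˡ (c ^ (n ℕ.∸ suc k))) (sym (ℤ.*-zeroˡ (c ^ (n ℕ.∸ k)))))
  pascal : ∀ k → c * term n j (suc k) + d * term n (suc j) k ≡ term (suc n) j (suc k)
  pascal k = begin
    c * (x * (c ^ (n ℕ.∸ suc k) * (d * d ^ k) * a 0 (suc k ℕ.+ j)))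
      + d * (y * (c ^ (n ℕ.∸ k) * d ^ k * a 0 (k ℕ.+ suc j)))
      ≡⟨ cong (λ i → c * (x * (c ^ (n ℕ.∸ suc k) * (d * d ^ k) * z)) + d * (y * (c ^ (n ℕ.∸ k) * d ^ k * a 0 i)))
           (ℕ.+-suc k j) ⟩
    c * (x * (c ^ (n ℕ.∸ suc k) * (d * d ^ k) * z)) + d * (y * (c ^ (n ℕ.∸ k) * d ^ k * z))
      ≡⟨ identity₁ c d x y (c ^ (n ℕ.∸ suc k)) (c ^ (n ℕ.∸ k)) (d ^ k) z ⟩
    (c * x * c ^ (n ℕ.∸ suc k) + y * c ^ (n ℕ.∸ k)) * (d * d ^ k * z)
      ≡⟨ cong (λ i → (i + y * c ^ (n ℕ.∸ k)) * (d * d ^ k * z)) (absorb k) ⟩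
    (x * c ^ (n ℕ.∸ k) + y * c ^ (n ℕ.∸ k)) * (d * d ^ k * z)
      ≡⟨ identity₂ x y (c ^ (n ℕ.∸ k)) (d * d ^ k) z ⟩
    (y + x) * (c ^ (n ℕ.∸ k) * (d * d ^ k) * z)
      ≡⟨ cong (_* (c ^ (n ℕ.∸ k) * (d * d ^ k) * z))
           (trans (sym (ℤ.pos-+ (n C k) (n C suc k))) (cong +_ (nCk+nC[k+1]≡[n+1]C[k+1] n k))) ⟩
    + (suc n C suc k) * (c ^ (n ℕ.∸ k) * (d * d ^ k) * z) ∎
    where
    x y z : ℤ
    x = + (n C suc k)
    y = + (n C k)
    z = a 0 (suc k ℕ.+ j)
    identity₁ : ∀ c d x y p q r z →
      c * (x * (p * (d * r) * z)) + d * (y * (q * r * z)) ≡ (c * x * p + y * q) * (d * r * z)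
    identity₁ = solve-∀
    identity₂ : ∀ x y q r z → (x * q + y * q) * (r * z) ≡ (y + x) * (q * r * z)
    identity₂ = solve-∀

-- Recurrences for binomial coefficients.

[1+k]*nC[1+k] : ∀ n k → suc k ℕ.* (suc n C suc k) ≡ suc n ℕ.* (n C k)
[1+k]*nC[1+k] zero    zero    = refl
[1+k]*nC[1+k] zero    (suc k) = trans (cong (suc (suc k) ℕ.*_) (k>n⇒nCk≡0 {1} {suc (suc k)} (s≤s (s≤s z≤n))))
  (trans (ℕ.*-zeroʳ (suc (suc k))) (sym (cong (1 ℕ.*_) (k>n⇒nCk≡0 {0} {suc k} (s≤s z≤n)))))
[1+k]*nC[1+k] (suc n) zero    = trans (ℕ.*-identityˡ _) (trans (nC1≡n (suc (suc n))) (sym (ℕ.*-identityʳ (suc (suc n)))))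
[1+k]*nC[1+k] (suc n) (suc k) = begin
  suc (suc k) ℕ.* (suc (suc n) C suc (suc k))
    ≡⟨ cong (suc (suc k) ℕ.*_) (nCk+nC[k+1]≡[n+1]C[k+1] (suc n) (suc k)) ⟨
  suc (suc k) ℕ.* (x ℕ.+ (suc n C suc (suc k)))
    ≡⟨ identity₁ k x (suc n C suc (suc k)) ⟩
  x ℕ.+ (suc k ℕ.* x ℕ.+ suc (suc k) ℕ.* (suc n C suc (suc k)))
    ≡⟨ cong (x ℕ.+_) (cong₂ ℕ._+_ ([1+k]*nC[1+k] n k) ([1+k]*nC[1+k] n (suc k))) ⟩
  x ℕ.+ (suc n ℕ.* (n C k) ℕ.+ suc n ℕ.* (n C suc k))
    ≡⟨ cong (x ℕ.+_) (ℕ.*-distribˡ-+ (suc n) (n C k) (n C suc k)) ⟨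
  x ℕ.+ suc n ℕ.* ((n C k) ℕ.+ (n C suc k))
    ≡⟨ cong (λ y → x ℕ.+ suc n ℕ.* y) (nCk+nC[k+1]≡[n+1]C[k+1] n k) ⟩
  x ℕ.+ suc n ℕ.* x ∎
  where
  open ≡-Reasoning
  x : ℕ
  x = suc n C suc k
  identity₁ : ∀ k x y → suc (suc k) ℕ.* (x ℕ.+ y) ≡ x ℕ.+ (suc k ℕ.* x ℕ.+ suc (suc k) ℕ.* y)
  identity₁ = ℕRing.solve-∀

-- The usual ratio of neighbours in a row, `(k + 1) C(n, k + 1) = (n - k) C(n, k)`, rearranged to
-- avoid truncated subtraction. Adding `n C k` to both sides reduces it to Pascal's rule and
-- absorption.
[1+k]*nC[1+k]+k*nCk : ∀ n k → suc k ℕ.* (n C suc k) ℕ.+ k ℕ.* (n C k) ≡ n ℕ.* (n C k)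
[1+k]*nC[1+k]+k*nCk n k = ℕ.+-cancelʳ-≡ (n C k) _ _ (begin
  suc k ℕ.* (n C suc k) ℕ.+ k ℕ.* (n C k) ℕ.+ (n C k)  ≡⟨ identity k (n C k) (n C suc k) ⟩
  suc k ℕ.* ((n C k) ℕ.+ (n C suc k))
    ≡⟨ cong (suc k ℕ.*_) (nCk+nC[k+1]≡[n+1]C[k+1] n k) ⟩
  suc k ℕ.* (suc n C suc k)                            ≡⟨ [1+k]*nC[1+k] n k ⟩
  (n C k) ℕ.+ n ℕ.* (n C k)                            ≡⟨ ℕ.+-comm (n C k) (n ℕ.* (n C k)) ⟩
  n ℕ.* (n C k) ℕ.+ (n C k)                            ∎)
  where
  open ≡-Reasoning
  identity : ∀ k x y → suc k ℕ.* y ℕ.+ k ℕ.* x ℕ.+ x ≡ suc k ℕ.* (x ℕ.+ y)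
  identity = ℕRing.solve-∀

-- Absorption is used twice, in rows `2k + 2` and `2k + 1`. In between, the two middle coefficients
-- of row `2k + 1` are exchanged; their equality comes from the ratio of neighbours, as
-- `(2k + 1) - k = k + 1`.
centralC : ∀ k → suc k ℕ.* ((2 ℕ.* suc k) C suc k) ≡ 2 ℕ.* suc (2 ℕ.* k) ℕ.* ((2 ℕ.* k) C k)
centralC k = begin
  suc k ℕ.* ((2 ℕ.* suc k) C suc k)        ≡⟨ cong (λ i → suc k ℕ.* (i C suc k)) (ℕ.*-suc 2 k) ⟩
  suc k ℕ.* (suc N C suc k)                ≡⟨ [1+k]*nC[1+k] N k ⟩
  suc N ℕ.* (N C k)                        ≡⟨ identity₁ k (N C k) ⟩
  2 ℕ.* (suc k ℕ.* (N C k))                ≡⟨ cong (2 ℕ.*_) symmetric ⟨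
  2 ℕ.* (suc k ℕ.* (N C suc k))            ≡⟨ cong (2 ℕ.*_) ([1+k]*nC[1+k] (2 ℕ.* k) k) ⟩
  2 ℕ.* (N ℕ.* ((2 ℕ.* k) C k))            ≡⟨ ℕ.*-assoc 2 N ((2 ℕ.* k) C k) ⟨
  2 ℕ.* N ℕ.* ((2 ℕ.* k) C k)              ∎
  where
  open ≡-Reasoning
  N : ℕ
  N = suc (2 ℕ.* k)
  identity₁ : ∀ k x → suc (suc (2 ℕ.* k)) ℕ.* x ≡ 2 ℕ.* (suc k ℕ.* x)
  identity₁ = ℕRing.solve-∀
  identity₂ : ∀ k x → suc (2 ℕ.* k) ℕ.* x ≡ suc k ℕ.* x ℕ.+ k ℕ.* x
  identity₂ = ℕRing.solve-∀
  symmetric : suc k ℕ.* (N C suc k) ≡ suc k ℕ.* (N C k)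
  symmetric = ℕ.+-cancelʳ-≡ (k ℕ.* (N C k)) _ _
    (trans ([1+k]*nC[1+k]+k*nCk N k) (identity₂ k (N C k)))

-- Congruences between integers and their compatibility with shift operators.

module Congruence (p : ℕ) where

  infix 4 _≈_ _≉_

  -- A record rather than a bare divisibility, so that both sides can be inferred from a congruence.
  record _≈_ (a b : ℤ) : Set where
    constructor congruent
    field difference : + p ∣ a - b

  open _≈_ public

  _≉_ : ℤ → ℤ → Set
  a ≉ b = ¬ (a ≈ b)

  private
    via : ∀ {a b c} → c ≡ a - b → + p ∣ c → a ≈ b
    via eq d = congruent (subst (+ p ∣_) eq d)

  ≡⇒≈ : ∀ {a b} → a ≡ b → a ≈ b
  ≡⇒≈ {a} refl = via (sym (ℤ.+-inverseʳ a)) (divides 0ℤ refl)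

  ≈-refl : ∀ {a} → a ≈ a
  ≈-refl = ≡⇒≈ refl

  ≈-sym : ∀ {a b} → a ≈ b → b ≈ a
  ≈-sym {a} {b} (congruent d) = via (identity a b) (∣m⇒∣-m d)
    where
    identity : ∀ a b → - (a - b) ≡ b - a
    identity = solve-∀

  ≈-trans : ∀ {a b c} → a ≈ b → b ≈ c → a ≈ c
  ≈-trans {a} {b} {c} (congruent d) (congruent e) = via (identity a b c) (∣m∣n⇒∣m+n d e)
    where
    identity : ∀ a b c → a - b + (b - c) ≡ a - c
    identity = solve-∀

  ≈-setoid : Setoid 0ℓ 0ℓ
  ≈-setoid = record { Carrier = ℤ ; _≈_ = _≈_ ;
    isEquivalence = record { refl = ≈-refl ; sym = ≈-sym ; trans = ≈-trans } }

  module ≈-Reasoning = Relation.Binary.Reasoning.Setoid ≈-setoid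

  ≈-+ : ∀ {a b c d} → a ≈ b → c ≈ d → a + c ≈ b + d
  ≈-+ {a} {b} {c} {d} (congruent x) (congruent y) = via (identity a b c d) (∣m∣n⇒∣m+n x y)
    where
    identity : ∀ a b c d → a - b + (c - d) ≡ a + c - (b + d)
    identity = solve-∀

  ≈-*ˡ : ∀ a {b c} → b ≈ c → a * b ≈ a * c
  ≈-*ˡ a {b} {c} (congruent d) = via (identity a b c) (∣n⇒∣m*n a d)
    where
    identity : ∀ a b c → a * (b - c) ≡ a * b - a * c
    identity = solve-∀

  ≈-*ʳ : ∀ a {b c} → b ≈ c → b * a ≈ c * a
  ≈-*ʳ a {b} {c} (congruent d) = via (identity a b c) (∣m⇒∣m*n a d)
    where
    identity : ∀ a b c → (b - c) * a ≡ b * a - c * a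
    identity = solve-∀

  ≈-- : ∀ {a b c d} → a ≈ b → c ≈ d → a - c ≈ b - d
  ≈-- {a} {b} {c} {d} (congruent x) (congruent y) = via (identity a b c d) (∣m∣n⇒∣m+n x (∣m⇒∣-m y))
    where
    identity : ∀ a b c d → a - b + - (c - d) ≡ a - c - (b - d)
    identity = solve-∀

  ∣⇒≈0 : ∀ {a} → + p ∣ a → a ≈ 0ℤ
  ∣⇒≈0 {a} = via (sym (ℤ.+-identityʳ a))

  ≈0⇒∣ : ∀ {a} → a ≈ 0ℤ → + p ∣ a
  ≈0⇒∣ {a} (congruent d) = subst (+ p ∣_) (ℤ.+-identityʳ a) d

  *-≈0ˡ : ∀ {a} b → a ≈ 0ℤ → a * b ≈ 0ℤ
  *-≈0ˡ b a≈0 = ∣⇒≈0 (∣m⇒∣m*n b (≈0⇒∣ a≈0))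

  *-≈0ʳ : ∀ a {b} → b ≈ 0ℤ → a * b ≈ 0ℤ
  *-≈0ʳ a b≈0 = ∣⇒≈0 (∣n⇒∣m*n a (≈0⇒∣ b≈0))

  p≈0 : + p ≈ 0ℤ
  p≈0 = ∣⇒≈0 (divides 1ℤ (sym (ℤ.*-identityˡ (+ p))))

  sumTo-≈ : ∀ n {f g} → (∀ k → k ℕ.< n → f k ≈ g k) → sumTo n f ≈ sumTo n g
  sumTo-≈ zero    f≈g = ≈-refl
  sumTo-≈ (suc n) f≈g = ≈-+ (f≈g 0 (s≤s z≤n)) (sumTo-≈ n (λ k k<n → f≈g (suc k) (s≤s k<n)))

  act-≈ : ∀ cs {u v} → (∀ e → u e ≈ v e) → ∀ e → act cs u e ≈ act cs v e
  act-≈ []       u≈v e = ≈-refl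
  act-≈ (c ∷ cs) u≈v e = ≈-+ (≈-*ˡ c (u≈v e)) (act-≈ cs u≈v (suc e))

  iter-≈ : ∀ cs n {u v} → (∀ e → u e ≈ v e) → ∀ e → iter cs n u e ≈ iter cs n v e
  iter-≈ cs zero    u≈v = u≈v
  iter-≈ cs (suc n) u≈v = act-≈ cs (iter-≈ cs n u≈v)

  -- The `N`-th difference at `x` sees only the points from `x` to `x + N`. Unlike `iter-≈`, this
  -- applies to `ℓ i * w i ≈ 1`, which fails where `p` divides `ℓ i`.
  Δ-local : ∀ N {u v} x → (∀ i → i ℕ.≤ N → u (i ℕ.+ x) ≈ v (i ℕ.+ x)) → iter Δ N u x ≈ iter Δ N v x
  Δ-local zero    x u≈v = u≈v 0 z≤n
  Δ-local (suc N) {u} {v} x u≈v =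
    ≈-+ (≈-*ˡ 1ℤ (Δ-local N x (λ i i≤N → u≈v i (ℕ.m≤n⇒m≤1+n i≤N))))
        (≈-+ (≈-*ˡ -1ℤ (Δ-local N (suc x) shifted)) (≈-refl {0ℤ}))
    where
    shifted : ∀ i → i ℕ.≤ N → u (i ℕ.+ suc x) ≈ v (i ℕ.+ suc x)
    shifted i i≤N = subst (λ y → u y ≈ v y) (sym (ℕ.+-suc i x)) (u≈v (suc i) (s≤s i≤N))

  -- Each of the `n` factors `4Δ³ - 27T²` contributes either `Δ³` or `T²`, so every term of the
  -- expansion is a multiple of some `Δ³ᵏ g` at `2j + x` with `k + j = n`. Peeling off one factor at
  -- a time avoids computing the coefficients.
  Q-vanishes : ∀ n g x → (∀ k j → k ℕ.+ j ≡ n → iter Δ (3 ℕ.* k) g (2 ℕ.* j ℕ.+ x) ≈ 0ℤ) →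
    iter Q n g x ≈ 0ℤ
  Q-vanishes zero    g x h = h 0 0 refl
  Q-vanishes (suc n) g x h = ≈-trans (≡⇒≈ (Q-difference (iter Q n g) x))
    (≈-- (*-≈0ʳ (+ 4) (≈-trans (≡⇒≈ (iter-iter Δ 3 Q n g x)) (Q-vanishes n (iter Δ 3 g) x hΔ)))
         (*-≈0ʳ (+ 27) (Q-vanishes n g (2 ℕ.+ x) hT)))
    where
    hΔ : ∀ k j → k ℕ.+ j ≡ n → iter Δ (3 ℕ.* k) (iter Δ 3 g) (2 ℕ.* j ℕ.+ x) ≈ 0ℤ
    hΔ k j k+j≡n = ≈-trans
      (≡⇒≈ (trans (sym (iter-+ Δ (3 ℕ.* k) 3 g _)) (cong (λ N → iter Δ N g (2 ℕ.* j ℕ.+ x)) (identity k))))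
      (h (suc k) j (cong suc k+j≡n))
      where
      identity : ∀ k → 3 ℕ.* k ℕ.+ 3 ≡ 3 ℕ.* suc k
      identity = ℕRing.solve-∀
    hT : ∀ k j → k ℕ.+ j ≡ n → iter Δ (3 ℕ.* k) g (2 ℕ.* j ℕ.+ (2 ℕ.+ x)) ≈ 0ℤ
    hT k j k+j≡n = ≈-trans (≡⇒≈ (cong (iter Δ (3 ℕ.* k) g) (identity j x)))
                           (h k (suc j) (trans (ℕ.+-suc k j) (cong suc k+j≡n)))
      where
      identity : ∀ j x → 2 ℕ.* j ℕ.+ (2 ℕ.+ x) ≡ 2 ℕ.* suc j ℕ.+ x
      identity = ℕRing.solve-∀

-- Prime modulus: Frobenius, Fermat and the inverse sequence `w`.

module PrimeModulus (q : ℕ) (p-prime : Prime (2 ℕ.+ q)) where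

  p : ℕ
  p = 2 ℕ.+ q

  open Congruence p public

  ≈-zero-product : ∀ a b → a * b ≈ 0ℤ → a ≈ 0ℤ ⊎ b ≈ 0ℤ
  ≈-zero-product a b ab≈0 =
    Sum.map (∣⇒≈0 ∘ ∣ᵤ⇒∣) (∣⇒≈0 ∘ ∣ᵤ⇒∣)
      (euclidsLemma ∣ a ∣ ∣ b ∣ p-prime (subst (p ℕ.∣_) (ℤ.abs-* a b) (∣⇒∣ᵤ (≈0⇒∣ ab≈0))))

  ≈-cancel : ∀ {a} b → a ≉ 0ℤ → a * b ≈ 0ℤ → b ≈ 0ℤ
  ≈-cancel {a} b a≉0 ab≈0 with ≈-zero-product a b ab≈0
  ... | inj₁ a≈0 = contradiction a≈0 a≉0
  ... | inj₂ b≈0 = b≈0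

  small≉0 : ∀ k → 0 ℕ.< k → k ℕ.< p → + k ≉ 0ℤ
  small≉0 (suc k) _ k<p k≈0 = ℕ.>⇒∤ k<p (∣⇒∣ᵤ (≈0⇒∣ k≈0))

  1≉0 : 1ℤ ≉ 0ℤ
  1≉0 = small≉0 1 (s≤s z≤n) (s≤s (s≤s z≤n))

  ^-≉0 : ∀ {a} n → a ≉ 0ℤ → a ^ n ≉ 0ℤ
  ^-≉0 zero    a≉0 = 1≉0
  ^-≉0 {a} (suc n) a≉0 aⁿ⁺¹≈0 = ^-≉0 n a≉0 (≈-cancel (a ^ n) a≉0 aⁿ⁺¹≈0)

  -- Absorption turns `(k + 1) C(p, k + 1)` into a multiple of `p`, and `k + 1` is a unit.
  pC[1+k]≈0 : ∀ k → suc k ℕ.< p → + (p C suc k) ≈ 0ℤ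
  pC[1+k]≈0 k k<p = ≈-cancel (+ (p C suc k)) (small≉0 (suc k) (s≤s z≤n) k<p) (begin
    + suc k * + (p C suc k)      ≡⟨ ℤ.pos-* (suc k) (p C suc k) ⟨
    + (suc k ℕ.* (p C suc k))    ≡⟨ cong +_ ([1+k]*nC[1+k] (suc q) k) ⟩
    + (p ℕ.* (suc q C k))        ≡⟨ ℤ.pos-* p (suc q C k) ⟩
    + p * + (suc q C k)          ≈⟨ *-≈0ˡ (+ (suc q C k)) p≈0 ⟩
    0ℤ                           ∎)
    where open ≈-Reasoning

  -- The inner terms of the `p`-th power of `c + d T` vanish modulo `p`. Only the recurrence for `a`
  -- is assumed, so that `T` can be multiplication by a number, as in `fermat`, or the difference
  -- operator, as in `Lᵖ-w`.
  frobenius : ∀ (c d : ℤ) (a : ℕ → Seq) →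
    (∀ n j → a (suc n) j ≡ c * a n j + d * a n (suc j)) →
    ∀ j → a p j ≈ c ^ p * a 0 j + d ^ p * a 0 (p ℕ.+ j)
  frobenius c d a step j = begin
    a p j
      ≡⟨ binomial c d a step p (suc p) j ℕ.≤-refl ⟩
    sumTo (suc p) term
      ≡⟨ sumTo-last p term ⟩
    term 0 + sumTo (suc q) (λ k → term (suc k)) + term p
      ≈⟨ ≈-+ (≈-+ (≡⇒≈ first)
           (≈-trans (sumTo-≈ (suc q) middle) (≡⇒≈ (sumTo-zero (suc q) _ (λ _ → refl)))))
           (≡⇒≈ last) ⟩
    c ^ p * a 0 j + 0ℤ + d ^ p * a 0 (p ℕ.+ j)
      ≡⟨ cong (λ i → i + d ^ p * a 0 (p ℕ.+ j)) (ℤ.+-identityʳ (c ^ p * a 0 j)) ⟩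
    c ^ p * a 0 j + d ^ p * a 0 (p ℕ.+ j) ∎
    where
    open ≈-Reasoning
    term : Seq
    term k = + (p C k) * (c ^ (p ℕ.∸ k) * d ^ k * a 0 (k ℕ.+ j))
    unit : ∀ x y → 1ℤ * (x * 1ℤ * y) ≡ x * y
    unit = solve-∀
    unit′ : ∀ x y → 1ℤ * (1ℤ * x * y) ≡ x * y
    unit′ = solve-∀
    first : term 0 ≡ c ^ p * a 0 j
    first = unit (c ^ p) (a 0 j)
    middle : ∀ k → k ℕ.< suc q → term (suc k) ≈ 0ℤ
    middle k k<q = *-≈0ˡ _ (pC[1+k]≈0 k (s≤s k<q))
    last : term p ≡ d ^ p * a 0 (p ℕ.+ j)
    last = trans (cong₂ (λ x i → + x * (c ^ i * d ^ p * a 0 (p ℕ.+ j))) (nCn≡1 p) (ℕ.n∸n≡0 p))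
                 (unit′ (d ^ p) (a 0 (p ℕ.+ j)))

  fermat : ∀ x → (+ x) ^ p ≈ + x
  fermat zero    = ≈-refl
  fermat (suc x) = begin
    (+ suc x) ^ p                                    ≡⟨ ℤ.*-identityʳ ((+ suc x) ^ p) ⟨
    (+ suc x) ^ p * 1ℤ
      -- Raising `j` multiplies by `x`, so the recurrence is `1 + x` acting on powers of `x`; the
      -- result is `(1 + x)ᵖ ≈ 1 + xᵖ`.
      ≈⟨ frobenius 1ℤ 1ℤ (λ n j → (+ suc x) ^ n * (+ x) ^ j) step 0 ⟩
    1ℤ ^ p * (1ℤ * 1ℤ) + 1ℤ ^ p * (1ℤ * (+ x) ^ (p ℕ.+ 0))
      ≡⟨ cong₂ (λ u i → u * (1ℤ * 1ℤ) + u * (1ℤ * (+ x) ^ i)) (ℤ.^-zeroˡ p) (ℕ.+-identityʳ p) ⟩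
    1ℤ * (1ℤ * 1ℤ) + 1ℤ * (1ℤ * (+ x) ^ p)           ≡⟨ unit ((+ x) ^ p) ⟩
    1ℤ + (+ x) ^ p                                   ≈⟨ ≈-+ (≈-refl {1ℤ}) (fermat x) ⟩
    + suc x                                          ∎
    where
    open ≈-Reasoning
    unit : ∀ y → 1ℤ * (1ℤ * 1ℤ) + 1ℤ * (1ℤ * y) ≡ 1ℤ + y
    unit = solve-∀
    step : ∀ n j → (+ suc x) * (+ suc x) ^ n * (+ x) ^ j ≡
      1ℤ * ((+ suc x) ^ n * (+ x) ^ j) + 1ℤ * ((+ suc x) ^ n * (+ x * (+ x) ^ j))
    step n j = identity (+ x) ((+ suc x) ^ n) ((+ x) ^ j)
      where
      identity : ∀ x y z → (1ℤ + x) * y * z ≡ 1ℤ * (y * z) + 1ℤ * (y * (x * z))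
      identity = solve-∀

  fermat-unit : ∀ x → + x ≉ 0ℤ → (+ x) ^ suc q ≈ 1ℤ
  fermat-unit x x≉0 = congruent (≈0⇒∣ (≈-cancel ((+ x) ^ suc q - 1ℤ) x≉0 (begin
    + x * ((+ x) ^ suc q - 1ℤ)  ≡⟨ identity (+ x) ((+ x) ^ suc q) ⟩
    (+ x) ^ p - + x             ≈⟨ ≈-- (fermat x) (≈-refl {+ x}) ⟩
    + x - + x                   ≡⟨ ℤ.+-inverseʳ (+ x) ⟩
    0ℤ                          ∎)))
    where
    open ≈-Reasoning
    identity : ∀ x y → x * (y - 1ℤ) ≡ x * y - x
    identity = solve-∀

  -- Modulo p this is 1 / (3e + 1), or 0 when p ∣ 3e + 1.
  w : Seq
  w e = ℓ e ^ q

  centralTerm : Seq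
  centralTerm k = + ((2 ℕ.* k) C k) * w k

  Δ-w : ∀ N → q ℕ.< N → ∀ e → iter Δ N w e ≡ 0ℤ
  Δ-w N q<N e = Δ-power q N q<N e

  Lᵖ-w : ∀ e → iter L p w e ≈ (+ 3) ^ p * w e
  Lᵖ-w e = begin
    iter L p w e
      -- As `L = 3 - Δ`, the index `j` counts applications of `Δ`; then `Δᵖ` kills `w` by degree.
      ≈⟨ frobenius (+ 3) -1ℤ (λ n j → iter L n (iter Δ j w) e) step 0 ⟩
    (+ 3) ^ p * w e + -1ℤ ^ p * iter Δ (p ℕ.+ 0) w e
      ≡⟨ cong (λ i → (+ 3) ^ p * w e + -1ℤ ^ p * i) (Δ-w (p ℕ.+ 0) (ℕ.m≤n⇒m≤n+o 0 (ℕ.n≤1+n (suc q))) e) ⟩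
    (+ 3) ^ p * w e + -1ℤ ^ p * 0ℤ
      ≡⟨ identity ((+ 3) ^ p * w e) (-1ℤ ^ p) ⟩
    (+ 3) ^ p * w e ∎
    where
    open ≈-Reasoning
    identity : ∀ x y → x + y * 0ℤ ≡ x
    identity = solve-∀
    L-Δ : ∀ u → act L u e ≡ + 3 * u e + -1ℤ * act Δ u e
    L-Δ u = three-minus (u e) (u (suc e))
      where
      three-minus : ∀ a b → + 2 * a + (1ℤ * b + 0ℤ) ≡ + 3 * a + -1ℤ * (1ℤ * a + (-1ℤ * b + 0ℤ))
      three-minus = solve-∀
    step : ∀ n j → iter L (suc n) (iter Δ j w) e ≡
      + 3 * iter L n (iter Δ j w) e + -1ℤ * iter L n (iter Δ (suc j) w) e
    step n j = trans (L-Δ (iter L n (iter Δ j w)))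
      (cong (λ i → + 3 * iter L n (iter Δ j w) e + -1ℤ * i) (sym (iter-act L n Δ (iter Δ j w) e)))

-- Vanishing of the sum of central terms modulo `p`.

module CentralSum
  (q : ℕ) (p-prime : Prime (2 ℕ.+ q))
  (n m : ℕ) (p≡1+2n : suc q ≡ 2 ℕ.* n) (p≡1+3m : suc q ≡ 3 ℕ.* m)
  where

  open PrimeModulus q p-prime public

  private
    3<p : 3 ℕ.< p
    3<p = s≤s (subst (3 ℕ.≤_) (sym p≡1+3m) (ℕ.*-monoʳ-≤ 3 (0<m m p≡1+3m)))
      where
      0<m : ∀ m → suc q ≡ 3 ℕ.* m → 0 ℕ.< m
      0<m (suc m) _ = s≤s z≤n

  3≉0 : + 3 ≉ 0ℤ
  3≉0 = small≉0 3 (s≤s z≤n) 3<p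

  -- 3(m + s) + 1 = p + 3s.
  ℓ≉0 : ∀ s → 0 ℕ.< s → s ℕ.< p → ℓ (m ℕ.+ s) ≉ 0ℤ
  ℓ≉0 s 0<s s<p ℓ≈0 = small≉0 s 0<s s<p (≈-cancel (+ s) 3≉0 (begin
    + 3 * + s            ≡⟨ identity₁ (+ p) (+ 3 * + s) ⟩
    + p + + 3 * + s - + p ≡⟨ cong (_- + p) ℓ≡ ⟨
    ℓ (m ℕ.+ s) - + p    ≈⟨ ≈-- ℓ≈0 p≈0 ⟩
    0ℤ                   ∎))
    where
    open ≈-Reasoning
    identity₁ : ∀ a b → b ≡ a + b - a
    identity₁ = solve-∀
    identity₂ : ∀ m s → 1 ℕ.+ 3 ℕ.* (m ℕ.+ s) ≡ suc (3 ℕ.* m) ℕ.+ 3 ℕ.* s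
    identity₂ = ℕRing.solve-∀
    ℓ≡ : ℓ (m ℕ.+ s) ≡ + p + + 3 * + s
    ℓ≡ = trans (cong +_ (trans (identity₂ m s) (cong (λ t → suc t ℕ.+ 3 ℕ.* s) (sym p≡1+3m))))
               (trans (ℤ.pos-+ p (3 ℕ.* s)) (cong (_+_ (+ p)) (ℤ.pos-* 3 s)))

  ℓ*w : ∀ s → 0 ℕ.< s → s ℕ.< p → ℓ (m ℕ.+ s) * w (m ℕ.+ s) ≈ 1ℤ
  ℓ*w s 0<s s<p = fermat-unit (1 ℕ.+ 3 ℕ.* (m ℕ.+ s)) (ℓ≉0 s 0<s s<p)

  -- If `3k > q`, the degree of `w` is too small. Otherwise put `K = 3k + 1` and
  -- `x = 2j = p - 1 - 2k`, so that `ℓ x = 3p - 2K`. With `D = Δ³ᵏ w`, Leibniz' rule gives modulo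
  -- `p` that `Δ` to the power `K` of `ℓ w` at `x` is `-2K Δ D - 3K T D = -K (2 + T) D`, which is
  -- `-K L D`. The left side is a difference of the constant 1, and `K < p` is a unit.
  Δ³ᵏ-L-w : ∀ k j → k ℕ.+ j ≡ n → iter Δ (3 ℕ.* k) (act L w) (2 ℕ.* j ℕ.+ 0) ≈ 0ℤ
  Δ³ᵏ-L-w k j k+j≡n with 3 ℕ.* k ℕ.≤? q
  ... | no  q<3k = ≡⇒≈ (begin
    iter Δ (3 ℕ.* k) (act L w) (2 ℕ.* j ℕ.+ 0)  ≡⟨ iter-act Δ (3 ℕ.* k) L w _ ⟩
    act L (iter Δ (3 ℕ.* k) w) (2 ℕ.* j ℕ.+ 0)  ≡⟨ act-cong L (Δ-w (3 ℕ.* k) (ℕ.≰⇒> q<3k)) _ ⟩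
    act L (λ _ → 0ℤ) (2 ℕ.* j ℕ.+ 0)            ≡⟨ act-zero L (2 ℕ.* j ℕ.+ 0) ⟩
    0ℤ                                          ∎)
    where open ≡-Reasoning
  ... | yes 3k≤q = begin
    iter Δ (3 ℕ.* k) (act L w) (2 ℕ.* j ℕ.+ 0)  ≡⟨ iter-act Δ (3 ℕ.* k) L w (2 ℕ.* j ℕ.+ 0) ⟩
    act L D (2 ℕ.* j ℕ.+ 0)                     ≡⟨ cong (act L D) (ℕ.+-identityʳ (2 ℕ.* j)) ⟩
    act L D x
      ≈⟨ ≈-cancel (act L D x) (small≉0 K (s≤s z≤n) (s≤s (s≤s 3k≤q))) K*LD≈0 ⟩
    0ℤ                                          ∎
    where
    open ≈-Reasoning
    K x : ℕ
    K = suc (3 ℕ.* k)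
    x = 2 ℕ.* j
    D : Seq
    D = iter Δ (3 ℕ.* k) w
    2k+x≡3m : 2 ℕ.* k ℕ.+ x ≡ 3 ℕ.* m
    2k+x≡3m = trans (sym (ℕ.*-distribˡ-+ 2 k j)) (trans (cong (2 ℕ.*_) k+j≡n) (trans (sym p≡1+2n) p≡1+3m))
    k<m : k ℕ.< m
    k<m = ℕ.*-cancelˡ-< 3 k m (subst (3 ℕ.* k ℕ.<_) p≡1+3m (s≤s 3k≤q))
    -- x = m + (2m - 2k), so that the K + 1 points from x on are m + s with 0 < s < p.
    r : ℕ
    r = m ℕ.∸ k
    m≡k+r : m ≡ k ℕ.+ r
    m≡k+r = sym (ℕ.m+[n∸m]≡n (ℕ.<⇒≤ k<m))
    x≡m+2r : x ≡ m ℕ.+ 2 ℕ.* r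
    x≡m+2r = ℕ.+-cancelˡ-≡ (2 ℕ.* k) x (m ℕ.+ 2 ℕ.* r)
      (trans 2k+x≡3m (trans (cong (λ i → i ℕ.+ 2 ℕ.* i) m≡k+r)
        (trans (identity k r) (cong (λ i → 2 ℕ.* k ℕ.+ (i ℕ.+ 2 ℕ.* r)) (sym m≡k+r)))))
      where
      identity : ∀ k r → k ℕ.+ r ℕ.+ 2 ℕ.* (k ℕ.+ r) ≡ 2 ℕ.* k ℕ.+ (k ℕ.+ r ℕ.+ 2 ℕ.* r)
      identity = ℕRing.solve-∀
    0<r : 0 ℕ.< r
    0<r = ℕ.m<n⇒0<n∸m k<m
    window : ∀ i → i ℕ.≤ K → ℓ (i ℕ.+ x) * w (i ℕ.+ x) ≈ 1ℤ
    window i i≤K = subst (λ y → ℓ y * w y ≈ 1ℤ) (trans (identity m r i) (cong (i ℕ.+_) (sym x≡m+2r)))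
      (ℓ*w (2 ℕ.* r ℕ.+ i) (ℕ.≤-trans 0<r (ℕ.≤-trans (ℕ.m≤m+n r _) (ℕ.m≤m+n (2 ℕ.* r) i))) bound)
      where
      identity : ∀ m r i → m ℕ.+ (2 ℕ.* r ℕ.+ i) ≡ i ℕ.+ (m ℕ.+ 2 ℕ.* r)
      identity = ℕRing.solve-∀
      3m≡ : ∀ k r → suc (2 ℕ.* r ℕ.+ suc (3 ℕ.* k)) ℕ.+ r ≡ 2 ℕ.+ 3 ℕ.* (k ℕ.+ r)
      3m≡ = ℕRing.solve-∀
      -- In the extreme case `i = K` the left side is `2r + 3k + 1 = p - r`, and `r` is positive.
      bound : 2 ℕ.* r ℕ.+ i ℕ.< p
      bound = ℕ.+-cancelʳ-≤ 1 _ _ (ℕ.≤-trans (ℕ.+-mono-≤ (s≤s (ℕ.+-monoʳ-≤ (2 ℕ.* r) i≤K)) 0<r)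
        (ℕ.≤-reflexive (trans (3m≡ k r) (trans (cong (λ i → 2 ℕ.+ 3 ℕ.* i) (sym m≡k+r))
          (trans (cong (2 ℕ.+_) (sym p≡1+3m)) (ℕ.+-comm 1 p))))))
    ℓx≡ : ℓ x ≡ + 3 * + p - + 2 * + K
    ℓx≡ = trans (add-sub (ℓ x) (+ 2 * + K)) (cong (_- + 2 * + K) (trans
      (sym (trans (ℤ.pos-+ (1 ℕ.+ 3 ℕ.* x) (2 ℕ.* K)) (cong (_+_ (ℓ x)) (ℤ.pos-* 2 K))))
      (trans (cong +_ (trans (identity k x) (cong (λ t → 3 ℕ.+ 3 ℕ.* t) (trans 2k+x≡3m (sym p≡1+3m)))))
        (trans (cong +_ (sym (ℕ.*-suc 3 (suc q)))) (ℤ.pos-* 3 p)))))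
      where
      add-sub : ∀ a b → a ≡ a + b - b
      add-sub = solve-∀
      identity : ∀ k x → 1 ℕ.+ 3 ℕ.* x ℕ.+ 2 ℕ.* suc (3 ℕ.* k) ≡ 3 ℕ.+ 3 ℕ.* (2 ℕ.* k ℕ.+ x)
      identity = ℕRing.solve-∀
    K*LD≈0 : + K * act L D x ≈ 0ℤ
    K*LD≈0 = begin
      + K * act L D x
        -- An exact identity over the integers: the leading multiple of `p` compensates the `3p` in
        -- `ℓ x`.
        ≡⟨ identity (+ p) (+ K) (D x) (D (suc x)) ⟩
      + p * (+ 3 * act Δ D x) - ((+ 3 * + p - + 2 * + K) * act Δ D x - + 3 * + K * D (suc x))
        ≡⟨ cong (λ l → + p * (+ 3 * act Δ D x) - (l * act Δ D x - + 3 * + K * D (suc x))) ℓx≡ ⟨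
      + p * (+ 3 * act Δ D x) - (ℓ x * act Δ D x - + 3 * + K * D (suc x))
        ≡⟨ cong (λ y → + p * (+ 3 * act Δ D x) - y) (Δ-leibniz (3 ℕ.* k) w x) ⟨
      + p * (+ 3 * act Δ D x) - iter Δ K (λ i → ℓ i * w i) x
        ≈⟨ ≈-- (*-≈0ˡ (+ 3 * act Δ D x) p≈0) (≈-trans (Δ-local K x window) (≡⇒≈ (Δ-one (3 ℕ.* k) x))) ⟩
      0ℤ ∎
      where
      identity : ∀ p K a b → K * (+ 2 * a + (1ℤ * b + 0ℤ)) ≡
        p * (+ 3 * (1ℤ * a + (-1ℤ * b + 0ℤ))) -
          ((+ 3 * p - + 2 * K) * (1ℤ * a + (-1ℤ * b + 0ℤ)) - + 3 * K * b)
      identity = solve-∀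

  -- The unit `3ᵖ` is traded for `Lᵖ`. Of these `2n + 1` factors `L`, `2n` complete `Mⁿ` to `Qⁿ`,
  -- and the last stays on `w` as `Δ³ᵏ-L-w` requires.
  Mⁿ-w : iter M n w 0 ≈ 0ℤ
  Mⁿ-w = ≈-cancel (iter M n w 0) (^-≉0 p 3≉0) (begin
    (+ 3) ^ p * iter M n w 0                   ≡⟨ ℤ.+-identityʳ _ ⟨
    -- The scalar is written as an operator of degree 0, so that it passes through `Mⁿ` by
    -- commutation.
    act ((+ 3) ^ p ∷ []) (iter M n w) 0        ≡⟨ iter-act M n ((+ 3) ^ p ∷ []) w 0 ⟨
    iter M n (act ((+ 3) ^ p ∷ []) w) 0
      ≈⟨ iter-≈ M n (λ e → ≈-trans (≡⇒≈ (ℤ.+-identityʳ ((+ 3) ^ p * w e))) (≈-sym (Lᵖ-w e))) 0 ⟩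
    iter M n (iter L p w) 0
      ≡⟨ iter-cong M n (λ e → sym (iter-act L (suc q) L w e)) 0 ⟩
    iter M n (iter L (suc q) (act L w)) 0
      ≡⟨ cong (λ i → iter M n (iter L i (act L w)) 0) (trans p≡1+2n (ℕ.*-comm 2 n)) ⟩
    iter M n (iter L (n ℕ.* 2) (act L w)) 0    ≡⟨ iter-Q-factor n (act L w) 0 ⟨
    iter Q n (act L w) 0                       ≈⟨ Q-vanishes n (act L w) 0 Δ³ᵏ-L-w ⟩
    0ℤ                                         ∎)
    where open ≈-Reasoning

  -- (2k choose k) = (-4)ᵏ (-1/2 choose k), and n = -1/2 modulo p.
  central-≈ : ∀ k → k ℕ.≤ n → + ((2 ℕ.* k) C k) ≈ + (n C k) * (- + 4) ^ k
  central-≈ zero    _   = ≈-refl {1ℤ}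
  central-≈ (suc k) k<n = congruent (≈0⇒∣ (≈-cancel
    (X′ - Y′ * (- + 4 * z)) (small≉0 (suc k) (s≤s z≤n) 1+k<p) (begin
    K * (X′ - Y′ * (- + 4 * z))
      ≡⟨ identity₁ K X′ Y′ z ⟩
    K * X′ + + 4 * (K * Y′) * z
      ≡⟨ cong₂ (λ a b → a + + 4 * b * z) X-step Y-step ⟩
    + 2 * (1ℤ + + 2 * + k) * X + + 4 * (+ n * Y - + k * Y) * z
      ≈⟨ ≈-+ (≈-*ˡ (+ 2 * (1ℤ + + 2 * + k)) (central-≈ k (ℕ.<⇒≤ k<n))) (≈-refl {+ 4 * (+ n * Y - + k * Y) * z}) ⟩
    + 2 * (1ℤ + + 2 * + k) * (Y * z) + + 4 * (+ n * Y - + k * Y) * z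
      -- The coefficients combine as `2(1 + 2k) + 4(n - k) = 2(1 + 2n) = 2p`.
      ≡⟨ identity₂ (+ k) (+ n) Y z ⟩
    (1ℤ + + 2 * + n) * (+ 2 * Y * z)
      ≡⟨ cong (λ i → (1ℤ + i) * (+ 2 * Y * z)) (trans (sym (ℤ.pos-* 2 n)) (cong +_ (sym p≡1+2n))) ⟩
    + p * (+ 2 * Y * z)
      ≈⟨ *-≈0ˡ (+ 2 * Y * z) p≈0 ⟩
    0ℤ ∎)))
    where
    open ≈-Reasoning
    K X X′ Y Y′ z : ℤ
    K  = + suc k
    X  = + ((2 ℕ.* k) C k)
    X′ = + ((2 ℕ.* suc k) C suc k)
    Y  = + (n C k)
    Y′ = + (n C suc k)
    z  = (- + 4) ^ k
    1+k<p : suc k ℕ.< p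
    1+k<p = s≤s (ℕ.≤-trans k<n (ℕ.≤-trans (ℕ.m≤m+n n _) (ℕ.≤-reflexive (sym p≡1+2n))))
    X-step : K * X′ ≡ + 2 * (1ℤ + + 2 * + k) * X
    X-step = trans (sym (ℤ.pos-* (suc k) ((2 ℕ.* suc k) C suc k)))
      (trans (cong +_ (centralC k))
        (trans (ℤ.pos-* (2 ℕ.* suc (2 ℕ.* k)) ((2 ℕ.* k) C k))
          (cong (_* X) (trans (ℤ.pos-* 2 (suc (2 ℕ.* k))) (cong (λ i → + 2 * (1ℤ + i)) (ℤ.pos-* 2 k))))))
    Y-step : K * Y′ ≡ + n * Y - + k * Y
    Y-step = trans (add-sub (K * Y′) (+ k * Y)) (cong (_- + k * Y)
      (trans (cong₂ _+_ (sym (ℤ.pos-* (suc k) (n C suc k))) (sym (ℤ.pos-* k (n C k))))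
        (trans (sym (ℤ.pos-+ (suc k ℕ.* (n C suc k)) (k ℕ.* (n C k))))
          (trans (cong +_ ([1+k]*nC[1+k]+k*nCk n k)) (ℤ.pos-* n (n C k))))))
      where
      add-sub : ∀ a b → a ≡ a + b - b
      add-sub = solve-∀
    identity₁ : ∀ K x y z → K * (x - y * (- + 4 * z)) ≡ K * x + + 4 * (K * y) * z
    identity₁ = solve-∀
    identity₂ : ∀ k n y z →
      + 2 * (1ℤ + + 2 * k) * (y * z) + + 4 * (n * y - k * y) * z ≡ (1ℤ + + 2 * n) * (+ 2 * y * z)
    identity₂ = solve-∀

  -- After `central-≈`, the sum is the binomial expansion of `(1 - 4T)ⁿ w` at 0.
  central-sum≈0 : sumTo (suc n) centralTerm ≈ 0ℤ
  central-sum≈0 = begin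
    sumTo (suc n) centralTerm
      ≈⟨ sumTo-≈ (suc n) (λ k k≤n → ≈-*ʳ (w k) (central-≈ k (ℕ.s≤s⁻¹ k≤n))) ⟩
    sumTo (suc n) (λ k → + (n C k) * (- + 4) ^ k * w k)
      ≡⟨ sumTo-cong (suc n) term ⟨
    sumTo (suc n) (λ k → + (n C k) * (1ℤ ^ (n ℕ.∸ k) * (- + 4) ^ k * w (k ℕ.+ 0)))
      ≡⟨ binomial 1ℤ (- + 4) (λ n → iter M n w) M-step n (suc n) 0 ℕ.≤-refl ⟨
    iter M n w 0
      ≈⟨ Mⁿ-w ⟩
    0ℤ ∎
    where
    open ≈-Reasoning
    M-step : ∀ n j → iter M (suc n) w j ≡ 1ℤ * iter M n w j + - + 4 * iter M n w (suc j)
    M-step n j = cong (_+_ (1ℤ * iter M n w j)) (ℤ.+-identityʳ (- + 4 * iter M n w (suc j)))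
    term : ∀ k → + (n C k) * (1ℤ ^ (n ℕ.∸ k) * (- + 4) ^ k * w (k ℕ.+ 0)) ≡ + (n C k) * (- + 4) ^ k * w k
    term k = trans (cong₂ (λ u i → + (n C k) * (u * (- + 4) ^ k * w i)) (ℤ.^-zeroˡ (n ℕ.∸ k)) (ℕ.+-identityʳ k))
                   (identity (+ (n C k)) ((- + 4) ^ k) (w k))
      where
      identity : ∀ a b c → a * (1ℤ * b * c) ≡ a * b * c
      identity = solve-∀

-- Integers inside the rationals, and reduced denominators.

ι : ℤ → ℚ
ι a = a / 1

ι-+ : ∀ a b → ι (a + b) ≡ ι a ℚ.+ ι b
ι-+ a b = ℚ.toℚᵘ-injective (begin
  toℚᵘ (ι (a + b))                 ≈⟨ ℚ.toℚᵘ-fromℚᵘ (mkℚᵘ (a + b) 0) ⟩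
  mkℚᵘ (a + b) 0                   ≈⟨ *≡* (identity a b) ⟩
  mkℚᵘ a 0 ℚᵘ.+ mkℚᵘ b 0
    ≈⟨ ℚᵘ.+-cong (ℚ.toℚᵘ-fromℚᵘ (mkℚᵘ a 0)) (ℚ.toℚᵘ-fromℚᵘ (mkℚᵘ b 0)) ⟨
  toℚᵘ (ι a) ℚᵘ.+ toℚᵘ (ι b)       ≈⟨ ℚ.toℚᵘ-homo-+ (ι a) (ι b) ⟨
  toℚᵘ (ι a ℚ.+ ι b)               ∎)
  where
  open ℚᵘ.≃-Reasoning
  identity : ∀ a b → (a + b) * 1ℤ ≡ (a * 1ℤ + b * 1ℤ) * 1ℤ
  identity = solve-∀

ι-* : ∀ a b → ι (a * b) ≡ ι a ℚ.* ι b
ι-* a b = ℚ.toℚᵘ-injective (begin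
  toℚᵘ (ι (a * b))                 ≈⟨ ℚ.toℚᵘ-fromℚᵘ (mkℚᵘ (a * b) 0) ⟩
  mkℚᵘ a 0 ℚᵘ.* mkℚᵘ b 0
    ≈⟨ ℚᵘ.*-cong (ℚ.toℚᵘ-fromℚᵘ (mkℚᵘ a 0)) (ℚ.toℚᵘ-fromℚᵘ (mkℚᵘ b 0)) ⟨
  toℚᵘ (ι a) ℚᵘ.* toℚᵘ (ι b)       ≈⟨ ℚ.toℚᵘ-homo-* (ι a) (ι b) ⟨
  toℚᵘ (ι a ℚ.* ι b)               ∎)
  where open ℚᵘ.≃-Reasoning

/-*-ι : ∀ a d → (a / suc d) ℚ.* ι (+ suc d) ≡ ι a
/-*-ι a d = ℚ.toℚᵘ-injective (begin
  toℚᵘ ((a / suc d) ℚ.* ι (+ suc d))          ≈⟨ ℚ.toℚᵘ-homo-* (a / suc d) (ι (+ suc d)) ⟩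
  toℚᵘ (a / suc d) ℚᵘ.* toℚᵘ (ι (+ suc d))
    ≈⟨ ℚᵘ.*-cong (ℚ.toℚᵘ-fromℚᵘ (mkℚᵘ a d)) (ℚ.toℚᵘ-fromℚᵘ (mkℚᵘ (+ suc d) 0)) ⟩
  mkℚᵘ a d ℚᵘ.* mkℚᵘ (+ suc d) 0
    ≈⟨ *≡* (trans (ℤ.*-identityʳ (a * + suc d)) (cong (λ k → a * + k) (sym (ℕ.*-identityʳ (suc d))))) ⟩
  mkℚᵘ a 0                                    ≈⟨ ℚ.toℚᵘ-fromℚᵘ (mkℚᵘ a 0) ⟨
  toℚᵘ (ι a)                                  ∎)
  where open ℚᵘ.≃-Reasoning

-- For `x = n / e` in lowest terms the hypothesis reads `n d = a e`, and `e` is coprime to `n`.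
↧∣ : ∀ x d a → x ℚ.* ι (+ d) ≡ ι a → ↧ₙ x ℕ.∣ d
↧∣ x@(mkℚ n e c) d a xd≡a = coprime-divisor (coprime-sym (recompute c))
  (subst (suc e ℕ.∣_) (ℤ.abs-* n (+ d)) (∣⇒∣ᵤ (divides a nd≡ae)))
  where
  x*d≃a : mkℚᵘ n e ℚᵘ.* mkℚᵘ (+ d) 0 ℚᵘ.≃ mkℚᵘ a 0
  x*d≃a = begin
    mkℚᵘ n e ℚᵘ.* mkℚᵘ (+ d) 0       ≈⟨ ℚᵘ.*-congˡ {mkℚᵘ n e} (ℚ.toℚᵘ-fromℚᵘ (mkℚᵘ (+ d) 0)) ⟨
    toℚᵘ x ℚᵘ.* toℚᵘ (ι (+ d))       ≈⟨ ℚ.toℚᵘ-homo-* x (ι (+ d)) ⟨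
    toℚᵘ (x ℚ.* ι (+ d))             ≈⟨ ℚ.toℚᵘ-cong xd≡a ⟩
    toℚᵘ (ι a)                       ≈⟨ ℚ.toℚᵘ-fromℚᵘ (mkℚᵘ a 0) ⟩
    mkℚᵘ a 0                         ∎
    where open ℚᵘ.≃-Reasoning
  nd≡ae : n * + d ≡ a * + suc e
  nd≡ae = trans (sym (ℤ.*-identityʳ (n * + d)))
    (trans (ℚᵘ.drop-*≡* x*d≃a) (cong (λ k → a * + k) (ℕ.*-identityʳ (suc e))))

-- Residues modulo `p` of rationals with denominator prime to `p`.

module Residues (q : ℕ) (p-prime : Prime (2 ℕ.+ q)) where

  open PrimeModulus q p-prime

  -- The fraction need not be in lowest terms: sums can then use the product of the denominators,
  -- and the reduced denominator enters only at the end, through `↧∣`.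
  record _hasResidue_ (x : ℚ) (a : ℤ) : Set where
    field
      numerator   : ℤ
      denominator : ℕ
      unit        : + denominator ≉ 0ℤ
      fraction    : x ℚ.* ι (+ denominator) ≡ ι numerator
      residue     : numerator ≈ a * + denominator

  open _hasResidue_

  hasResidue-0 : 0ℚ hasResidue 0ℤ
  hasResidue-0 = record { numerator = 0ℤ ; denominator = 1 ; unit = 1≉0 ; fraction = refl ; residue = ≈-refl }

  hasResidue-+ : ∀ {x y a b} → x hasResidue a → y hasResidue b → (x ℚ.+ y) hasResidue (a + b)
  hasResidue-+ {x} {y} {a} {b} r s = record
    { numerator   = N * + E + N′ * + D
    ; denominator = D ℕ.* E
    ; unit        = λ DE≈0 → unit s (≈-cancel (+ E) (unit r) (≈-trans (≡⇒≈ (sym (ℤ.pos-* D E))) DE≈0))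
    ; fraction    = begin
        (x ℚ.+ y) ℚ.* ι (+ (D ℕ.* E))
          ≡⟨ cong (λ i → (x ℚ.+ y) ℚ.* i) (trans (cong ι (ℤ.pos-* D E)) (ι-* (+ D) (+ E))) ⟩
        (x ℚ.+ y) ℚ.* (ι (+ D) ℚ.* ι (+ E))
          ≡⟨ distribute x y (ι (+ D)) (ι (+ E)) ⟩
        x ℚ.* ι (+ D) ℚ.* ι (+ E) ℚ.+ y ℚ.* ι (+ E) ℚ.* ι (+ D)
          ≡⟨ cong₂ (λ i j → i ℚ.* ι (+ E) ℚ.+ j ℚ.* ι (+ D)) (fraction r) (fraction s) ⟩
        ι N ℚ.* ι (+ E) ℚ.+ ι N′ ℚ.* ι (+ D)
          ≡⟨ cong₂ ℚ._+_ (ι-* N (+ E)) (ι-* N′ (+ D)) ⟨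
        ι (N * + E) ℚ.+ ι (N′ * + D)                          ≡⟨ ι-+ (N * + E) (N′ * + D) ⟨
        ι (N * + E + N′ * + D)                                 ∎
    ; residue     = ≈-trans (≈-+ (≈-*ʳ (+ E) (residue r)) (≈-*ʳ (+ D) (residue s)))
        (≡⇒≈ (trans (identity a b (+ D) (+ E)) (cong ((a + b) *_) (sym (ℤ.pos-* D E)))))
    }
    where
    open ≡-Reasoning
    N N′ : ℤ
    N = numerator r
    N′ = numerator s
    D E : ℕ
    D = denominator r
    E = denominator s
    identity : ∀ a b d e → a * d * e + b * e * d ≡ (a + b) * (d * e)
    identity = solve-∀
    distribute : ∀ x y d e → (x ℚ.+ y) ℚ.* (d ℚ.* e) ≡ x ℚ.* d ℚ.* e ℚ.+ y ℚ.* e ℚ.* d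
    distribute = solve 4 (λ x y d e → ((x :+ y) :* (d :* e)) := (((x :* d) :* e) :+ ((y :* e) :* d))) refl
      where open +-*-Solver

  -- A common divisor of the reduced denominator and `p` is 1 or `p`, and `p` would also divide `d`.
  unit⇒integral : ∀ x d a → + d ≉ 0ℤ → x ℚ.* ι (+ d) ≡ ι a → Integral p x
  unit⇒integral x d a d≉0 xd≡a (e∣↧x , e∣p) with prime⇒irreducible p-prime e∣p
  ... | inj₁ e≡1  = e≡1
  ... | inj₂ refl = contradiction (∣⇒≈0 (∣ᵤ⇒∣ (ℕ.∣-trans e∣↧x (↧∣ x d a xd≡a)))) d≉0

  -- The numerator is congruent to 0, hence equals `M p` for some `M`; the cofactor of `p` in `x` is
  -- then `M` over the same denominator.
  residue-0⇒≡0 : ∀ {x a} → x hasResidue a → a ≈ 0ℤ → x ≡ 0ℚ [mod p ]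
  residue-0⇒≡0 {x} {a} r a≈0 with denominator r | unit r | fraction r | residue r
  ... | zero  | D≉0 | _     | _   = contradiction ≈-refl D≉0
  ... | suc D | D≉0 | xD≡N | N≈aD with ≈0⇒∣ (≈-trans N≈aD (*-≈0ˡ (+ suc D) a≈0))
  ... | divides M N≡Mp =
    unit⇒integral x (suc D) (numerator r) D≉0 xD≡N ,
    (λ (e∣1 , _) → ℕ.∣1⇒≡1 e∣1) ,
    z , unit⇒integral z (suc D) M D≉0 zD≡M , (begin
      x ℚ.- 0ℚ                                           ≡⟨ ℚ.+-identityʳ x ⟩
      x                                                  ≡⟨ cancel x ⟩
      x ℚ.* ι (+ suc D) ℚ.* (+ 1 / suc D)                ≡⟨ cong (ℚ._* (+ 1 / suc D)) xD≡pzD ⟩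
      ι (+ p) ℚ.* z ℚ.* ι (+ suc D) ℚ.* (+ 1 / suc D)    ≡⟨ cancel (ι (+ p) ℚ.* z) ⟨
      ι (+ p) ℚ.* z                                      ∎)
    where
    open ≡-Reasoning
    z : ℚ
    z = M / suc D
    zD≡M : z ℚ.* ι (+ suc D) ≡ ι M
    zD≡M = /-*-ι M D
    cancel : ∀ y → y ≡ y ℚ.* ι (+ suc D) ℚ.* (+ 1 / suc D)
    cancel y = sym (trans (ℚ.*-assoc y (ι (+ suc D)) (+ 1 / suc D))
      (trans (cong (λ i → y ℚ.* i) (trans (ℚ.*-comm (ι (+ suc D)) (+ 1 / suc D)) (/-*-ι (+ 1) D)))
        (ℚ.*-identityʳ y)))
    xD≡pzD : x ℚ.* ι (+ suc D) ≡ ι (+ p) ℚ.* z ℚ.* ι (+ suc D)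
    xD≡pzD = begin
      x ℚ.* ι (+ suc D)                   ≡⟨ xD≡N ⟩
      ι (numerator r)                     ≡⟨ cong ι (trans N≡Mp (ℤ.*-comm M (+ p))) ⟩
      ι (+ p * M)                         ≡⟨ ι-* (+ p) M ⟩
      ι (+ p) ℚ.* ι M                     ≡⟨ cong (λ i → ι (+ p) ℚ.* i) zD≡M ⟨
      ι (+ p) ℚ.* (z ℚ.* ι (+ suc D))     ≡⟨ ℚ.*-assoc (ι (+ p)) z (ι (+ suc D)) ⟨
      ι (+ p) ℚ.* z ℚ.* ι (+ suc D)       ∎

  -- By Fermat, `w k` inverts the denominator `ℓ k` modulo `p`.
  summand-residue : ∀ k → ℓ k ≉ 0ℤ → summand k hasResidue centralTerm k
  summand-residue k ℓk≉0 = record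
    { numerator   = c
    ; denominator = 1 ℕ.+ 3 ℕ.* k
    ; unit        = ℓk≉0
    ; fraction    = /-*-ι c (3 ℕ.* k)
    ; residue     = ≈-sym (begin
        c * w k * ℓ k     ≡⟨ identity c (w k) (ℓ k) ⟩
        c * (ℓ k * w k)   ≈⟨ ≈-*ˡ c (fermat-unit (1 ℕ.+ 3 ℕ.* k) ℓk≉0) ⟩
        c * 1ℤ            ≡⟨ ℤ.*-identityʳ c ⟩
        c                 ∎)
    }
    where
    open ≈-Reasoning
    c : ℤ
    c = + ((2 ℕ.* k) C k)
    identity : ∀ a b c → a * b * c ≡ a * (c * b)
    identity = solve-∀

  -- The excluded index m contributes 0 on the right.
  ∑-residue : ∀ m → w m ≈ 0ℤ → ∀ ks → All (λ k → k ≢ m → ℓ k ≉ 0ℤ) ks →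
    ∃[ a ] (∑ (filter (λ k → ¬? (k ℕ.≟ m)) ks) summand hasResidue a ×
            a ≈ foldr _+_ 0ℤ (map centralTerm ks))
  ∑-residue m wm≈0 []       []             = 0ℤ , hasResidue-0 , ≈-refl
  ∑-residue m wm≈0 (k ∷ ks) (ℓk≉0 ∷ units) with k ℕ.≟ m | ∑-residue m wm≈0 ks units
  ... | yes refl | a , r , a≈ = a ,
    subst (λ ls → ∑ ls summand hasResidue a) (sym (filter-reject included? (λ k≢k → k≢k refl))) r , (begin
      a                                    ≈⟨ a≈ ⟩
      rest                                 ≡⟨ ℤ.+-identityˡ rest ⟨
      0ℤ + rest                            ≈⟨ ≈-+ (*-≈0ʳ (+ ((2 ℕ.* k) C k)) wm≈0) (≈-refl {rest}) ⟨
      centralTerm k + rest                 ∎)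
    where
    open ≈-Reasoning
    included? = λ i → ¬? (i ℕ.≟ m)
    rest = foldr _+_ 0ℤ (map centralTerm ks)
  ... | no  k≢m  | a , r , a≈ = centralTerm k + a ,
    subst (λ ls → ∑ ls summand hasResidue (centralTerm k + a))
      (sym (filter-accept (λ i → ¬? (i ℕ.≟ m)) k≢m)) (hasResidue-+ (summand-residue k (ℓk≉0 k≢m)) r) ,
    ≈-+ (≈-refl {centralTerm k}) a≈

-- Arithmetic of `p` and the final assembly.

foldr-applyUpTo : ∀ f n → foldr _+_ 0ℤ (applyUpTo f n) ≡ sumTo n f
foldr-applyUpTo f zero    = refl
foldr-applyUpTo f (suc n) = cong (_+_ (f 0)) (foldr-applyUpTo (λ k → f (suc k)) n)

prime-2 : ∀ {p} → Prime p → 2 ℕ.∣ p → p ≡ 2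
prime-2 p-prime 2∣p with prime⇒irreducible p-prime 2∣p
... | inj₂ refl = refl

2∣p-1 : ∀ r → Prime (suc r) → suc r % 3 ≡ 1 → 2 ℕ.∣ r
2∣p-1 r p-prime p%3≡1 with suc r % 2 in p%2 | ℕ.m%n<n (suc r) 2
-- An even prime is 2, which is not 1 modulo 3.
... | 0 | _ with refl ← prime-2 p-prime (ℕ.m%n≡0⇒n∣m (suc r) 2 p%2) = contradiction p%3≡1 λ ()
... | 1 | _ = ℕ.divides (suc r ℕ./ 2)
  (ℕ.suc-injective (trans (ℕ.m≡m%n+[m/n]*n (suc r) 2) (cong (ℕ._+ suc r ℕ./ 2 ℕ.* 2) p%2)))
... | suc (suc _) | s≤s (s≤s ())

3∣p-1 : ∀ r → suc r % 3 ≡ 1 → 3 ℕ.∣ r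
3∣p-1 r p%3≡1 = ℕ.divides (suc r ℕ./ 3)
  (ℕ.suc-injective (trans (ℕ.m≡m%n+[m/n]*n (suc r) 3) (cong (ℕ._+ suc r ℕ./ 3 ℕ.* 3) p%3≡1)))

theorem1p3 : (p : ℕ) → Prime p → p % 3 ≡ 1 → ∑ (indices p) summand ≡ 0ℚ [mod p ]
theorem1p3 0 p-prime _ = contradiction p-prime ¬prime[0]
theorem1p3 1 p-prime _ = contradiction p-prime ¬prime[1]
theorem1p3 (suc (suc q)) p-prime p%3≡1 =
  let a , r , a≈ = ∑-residue m wm≈0 (upTo (suc n))
        (applyUpTo⁺₁ (λ k → k) (suc n) (λ k≤n → ℓ-unit _ (ℕ.s≤s⁻¹ k≤n)))
  in residue-0⇒≡0 r (≈-trans a≈ (≈-trans (≡⇒≈ sum≡) central-sum≈0))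
  where
  n m : ℕ
  n = suc q ℕ./ 2
  m = suc q ℕ./ 3
  p≡1+2n : suc q ≡ 2 ℕ.* n
  p≡1+2n = sym (ℕ.m*[n/m]≡n (2∣p-1 (suc q) p-prime p%3≡1))
  p≡1+3m : suc q ≡ 3 ℕ.* m
  p≡1+3m = sym (ℕ.m*[n/m]≡n (3∣p-1 (suc q) p%3≡1))
  open CentralSum q p-prime n m p≡1+2n p≡1+3m
  open Residues q p-prime
  wm≈0 : w m ≈ 0ℤ
  -- Since `ℓ m = 1 + 3m = p`, the value `w m` is `p ^ q`. The exponent is positive, as `q = 0`
  -- would give `1 = 3m`.
  wm≈0 = ∣⇒≈0 (subst (λ t → + p ∣ (+ suc t) ^ q) p≡1+3m (∣-power q p≡1+3m))
    where
    ∣-power : ∀ q′ → suc q′ ≡ 3 ℕ.* m → + p ∣ (+ p) ^ q′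
    ∣-power zero     1≡3m = contradiction
      (ℕ.divides m (trans 1≡3m (ℕ.*-comm 3 m))) (ℕ.>⇒∤ (s≤s (s≤s z≤n)))
    ∣-power (suc q′) _    = ∣m⇒∣m*n ((+ p) ^ q′) (divides 1ℤ (sym (ℤ.*-identityˡ (+ p))))
  -- Below `m`, `ℓ k` lies strictly between 0 and `p`. Above `m`, `k = m + s` with `0 < s ≤ n < p`.
  ℓ-unit : ∀ k → k ℕ.≤ n → k ≢ m → ℓ k ≉ 0ℤ
  ℓ-unit k k≤n k≢m with ℕ.<-cmp k m
  ... | tri< k<m _ _ = small≉0 (1 ℕ.+ 3 ℕ.* k) (s≤s z≤n)
    (s≤s (subst (3 ℕ.* k ℕ.<_) (sym p≡1+3m) (ℕ.*-monoʳ-< 3 k<m)))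
  ... | tri≈ _ k≡m _ = contradiction k≡m k≢m
  ... | tri> _ _ m<k = subst (λ i → ℓ i ≉ 0ℤ) (ℕ.m+[n∸m]≡n (ℕ.<⇒≤ m<k))
    (ℓ≉0 (k ℕ.∸ m) (ℕ.m<n⇒0<n∸m m<k)
      (s≤s (ℕ.≤-trans (ℕ.m∸n≤m k m) (ℕ.≤-trans k≤n (ℕ.≤-trans (ℕ.m≤m+n n _) (ℕ.≤-reflexive (sym p≡1+2n)))))))
  sum≡ : foldr _+_ 0ℤ (map centralTerm (upTo (suc n))) ≡
    sumTo (suc n) centralTerm
  sum≡ = trans (cong (foldr _+_ 0ℤ) (map-upTo centralTerm (suc n))) (foldr-applyUpTo centralTerm (suc n))
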